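{- Let $(S,\dot\nabla,e)$ be the dagger Frobenius structure associated with a coherent configuration. Then the data $(S,\dot\nabla,e)$ uniquely determine the structure constants $\nabla$ of the coherent configuration. That is: if $(X,S)$ and $(X',S')$ are coherent configurations with structure constants $\nabla,\nabla'$ and associated dagger Frobenius structures $(S,\dot\nabla,e)$, $(S',\dot\nabla',e')$, and $\theta\colon S\to S'$ is a bijection with $(\dot\nabla')_{\theta(a)\theta(b)}^{\theta(c)}=\dot\nabla_{ab}^c$ and $(e')_*^{\theta(a)}=e_*^a$ for all $a,b,c\in S$, then $(\nabla')_{\theta(a)\theta(b)}^{\theta(c)}=\nabla_{ab}^c$ for all $a,b,c\in S$.
   Context: A coherent configuration $(X,S)$ is a finite set $X$ with a partition $S$ of $X\times X$ such that: if $p\in S$ contains some $(x,x)$ then $p\subseteq\mathrm{id}_X$; for $a,b,c\in S$ the number $\nabla_{ab}^c$ (structure constant) of $z\in X$ with $(x,z)\in a$, $(z,y)\in b$ is the same for all $(x,y)\in c$; and $c\in S$ implies $c^{ -1}=\{(y,x):(x,y)\in c\}\in S$. The valency $\|a\|$ of $a\in S$ is the number of $y\in X$ with $(x,y)\in a$, for any $x$ for which at least one such $y$ exists (independent of $x$). The dagger Frobenius structure associated with $(X,S)$ is $(S,\dot\nabla,e)$, where $\dot\nabla_{ab}^c=\sqrt{\frac{\|c\|}{\|a\|\|b\|}}\,\nabla_{ab}^c$ and $e_*^a=1$ if $a\subseteq\mathrm{id}_X$, $e_*^a=0$ otherwise. -}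

module Defs where

open import Data.Bool using (if_then_else_)
open import Data.Empty using (⊥)
open import Data.Fin using (Fin)
import Data.Fin.Properties as Fin
import Data.Integer as ℤ
open import Data.List using (List; []; _∷_; length; filter; allFin)
open import Data.List.Properties using (filter-some; filter-≐)
open import Data.List.Membership.Propositional using (lose)
open import Data.List.Membership.Propositional.Properties using (∈-allFin)
open import Data.Nat as ℕ using (ℕ; zero; suc; NonZero)
import Data.Nat.Properties as ℕ
open import Data.Product using (∃; ∃₂; _×_; _,_; proj₁; proj₂)
open import Data.Rational using
  (ℚ; 0ℚ; 1ℚ; -_; _+_; _-_; _*_; _/_; 1/_; _<_; _≤_; _<?_;
   Positive; positive; nonNegative)
import Data.Rational.Properties as ℚ
import Data.Rational.Solver as ℚ
open import Data.Sum using (_⊎_; inj₁; inj₂)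
open import Function using (_⇔_; mk⇔; Equivalence)
open import Relation.Binary.PropositionalEquality
  using (_≡_; refl; sym; trans; cong; subst; subst₂)
open import Relation.Nullary using (Dec; yes; no; does)
open import Relation.Nullary.Decidable using (_×-dec_; _→-dec_)
open import Relation.Unary using (Pred; Decidable)

------------------------------------------------------------------------
-- Real numbers as two-sided, located Dedekind cuts of ℚ

record ℝ : Set₁ where
  field
    L U         : ℚ → Set
    L-inhabited : ∃ L
    U-inhabited : ∃ U
    L-rounded   : ∀ q → L q ⇔ (∃ λ r → q < r × L r)
    U-rounded   : ∀ r → U r ⇔ (∃ λ q → q < r × U q)
    disjoint    : ∀ q → L q → U q → ⊥
    located     : ∀ q r → q < r → L q ⊎ U r

infix 4 _≃_

_≃_ : ℝ → ℝ → Set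
x ≃ y = ∀ q → (ℝ.L x q ⇔ ℝ.L y q) × (ℝ.U x q ⇔ ℝ.U y q)

private
  0<1 : 0ℚ < 1ℚ
  0<1 = ℚ.positive⁻¹ 1ℚ

  -1<0 : - 1ℚ < 0ℚ
  -1<0 = ℚ.neg-antimono-< 0<1

  p<p+1 : ∀ p → p < p + 1ℚ
  p<p+1 p = subst (_< p + 1ℚ) (ℚ.+-identityʳ p) (ℚ.+-monoʳ-< p 0<1)

  p-1<p : ∀ p → p - 1ℚ < p
  p-1<p p = subst (p - 1ℚ <_) (ℚ.+-identityʳ p) (ℚ.+-monoʳ-< p -1<0)

fromℚ : ℚ → ℝ
fromℚ p = record
  { L           = _< p
  ; U           = p <_
  ; L-inhabited = p - 1ℚ , p-1<p p
  ; U-inhabited = p + 1ℚ , p<p+1 p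
  ; L-rounded   = λ q → mk⇔ (λ q<p → ℚ.<-dense q<p)
                            (λ (r , q<r , r<p) → ℚ.<-trans q<r r<p)
  ; U-rounded   = λ r → mk⇔ (λ p<r → let (q , p<q , q<r) = ℚ.<-dense p<r
                                     in q , q<r , p<q)
                            (λ (q , q<r , p<q) → ℚ.<-trans p<q q<r)
  ; disjoint    = λ q q<p p<q → ℚ.<-asym q<p p<q
  ; located     = loc
  }
  where
  loc : ∀ q r → q < r → q < p ⊎ p < r
  loc q r q<r with q <? p
  ... | yes q<p = inj₁ q<p
  ... | no  q≮p = inj₂ (ℚ.≤-<-trans (ℚ.≮⇒≥ q≮p) q<r)

0ℝ 1ℝ : ℝ
0ℝ = fromℚ 0ℚ
1ℝ = fromℚ 1ℚ

0<r-p : ∀ {p r} → p < r → 0ℚ < r - p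
0<r-p {p} {r} p<r = subst (_< r - p) (ℚ.+-inverseʳ p) (ℚ.+-monoˡ-< (- p) p<r)

0<* : ∀ {p q} → 0ℚ < p → 0ℚ < q → 0ℚ < p * q
0<* {p} {q} 0<p 0<q = subst (_< p * q) (ℚ.*-zeroʳ p)
  (ℚ.*-monoʳ-<-pos p ⦃ positive 0<p ⦄ 0<q)

sq-mono-< : ∀ {q r} → 0ℚ ≤ q → q < r → q * q < r * r
sq-mono-< {q} {r} 0≤q q<r = ℚ.≤-<-trans
  (ℚ.*-monoˡ-≤-nonNeg q ⦃ nonNegative 0≤q ⦄ (ℚ.<⇒≤ q<r))
  (ℚ.*-monoˡ-<-pos r ⦃ positive (ℚ.≤-<-trans 0≤q q<r) ⦄ q<r)

small : ∀ {l b} → 0ℚ < l → 0ℚ ≤ b →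
        ∃ λ d → 0ℚ < d × d < 1ℚ × d * b < l
small {l} {b} 0<l 0≤b = d , 0<d , d<1 , db<l
  where
  k = b + (1ℚ + l)
  0<1+l : 0ℚ < 1ℚ + l
  0<1+l = ℚ.+-mono-< 0<1 0<l
  b<k : b < k
  b<k = subst (_< k) (ℚ.+-identityʳ b) (ℚ.+-monoʳ-< b 0<1+l)
  l<k : l < k
  l<k = subst (_< k) (trans (ℚ.+-identityˡ (0ℚ + l)) (ℚ.+-identityˡ l))
    (ℚ.+-mono-≤-< 0≤b (ℚ.+-monoˡ-< l 0<1))
  0<k : 0ℚ < k
  0<k = ℚ.≤-<-trans 0≤b b<k
  instance
    k-pos : Positive k
    k-pos = positive 0<k
    k-nonZero = ℚ.pos⇒nonZero k
  i = 1/ k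
  0<i : 0ℚ < i
  0<i = ℚ.positive⁻¹ i ⦃ ℚ.1/pos⇒pos k ⦄
  d = l * i
  0<d : 0ℚ < d
  0<d = 0<* 0<l 0<i
  dk≡l : d * k ≡ l
  dk≡l = trans (ℚ.*-assoc l i k)
    (trans (cong (l *_) (ℚ.*-inverseˡ k)) (ℚ.*-identityʳ l))
  d<1 : d < 1ℚ
  d<1 = ℚ.*-cancelʳ-<-nonNeg k ⦃ ℚ.pos⇒nonNeg k ⦄
    (subst₂ _<_ (sym dk≡l) (sym (ℚ.*-identityˡ k)) l<k)
  db<l : d * b < l
  db<l = subst (d * b <_) dk≡l (ℚ.*-monoʳ-<-pos d ⦃ positive 0<d ⦄ b<k)

sq-above : ∀ {p r} → 0ℚ ≤ r → r * r < p → ∃ λ s → r < s × s * s < p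
sq-above {p} {r} 0≤r rr<p =
  let l   = p - r * r
      b   = (r + r) + 1ℚ
      0≤b = ℚ.+-mono-≤ (ℚ.+-mono-≤ 0≤r 0≤r) (ℚ.<⇒≤ 0<1)
      (d , 0<d , d<1 , db<l) = small (0<r-p rr<p) 0≤b
      step : d * ((r + r) + d) < l
      step = ℚ.<-trans
        (ℚ.*-monoʳ-<-pos d ⦃ positive 0<d ⦄ (ℚ.+-monoʳ-< (r + r) d<1)) db<l
  in r + d
   , subst (_< r + d) (ℚ.+-identityʳ r) (ℚ.+-monoʳ-< r 0<d)
   , subst₂ _<_
       (solve 2 (λ r d → r :* r :+ d :* ((r :+ r) :+ d)
                      := (r :+ d) :* (r :+ d)) refl r d)
       (solve 2 (λ r p → r :* r :+ (p :- r :* r) := p) refl r p)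
       (ℚ.+-monoʳ-< (r * r) step)
  where open ℚ.+-*-Solver

sq-below : ∀ {p r} → 0ℚ < r → p < r * r →
           ∃ λ s → s < r × 0ℚ < s × p < s * s
sq-below {p} {r} 0<r p<rr =
  let l   = r * r - p
      b   = r * r + r * r
      0<b = ℚ.+-mono-< (0<* 0<r 0<r) (0<* 0<r 0<r)
      (d , 0<d , d<1 , db<l) = small (0<r-p p<rr) (ℚ.<⇒≤ 0<b)
      s   = r - r * d
      0<dr = 0<* 0<r 0<d
  in s
   , subst (s <_) (ℚ.+-identityʳ r) (ℚ.+-monoʳ-< r (ℚ.neg-antimono-< 0<dr))
   , subst (0ℚ <_)
       (solve 2 (λ r d → r :* (con 1ℚ :- d) := r :- r :* d) refl r d)
       (0<* 0<r (0<r-p d<1))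
   , subst₂ _<_
       (solve 2 (λ r p → (r :* r :+ (:- (r :* r :- p))) :+ con 0ℚ := p)
         refl r p)
       (solve 2 (λ r d →
           (r :* r :+ (:- (d :* (r :* r :+ r :* r)))) :+ (r :* d) :* (r :* d)
           := (r :- r :* d) :* (r :- r :* d)) refl r d)
       (ℚ.+-mono-< (ℚ.+-monoʳ-< (r * r) (ℚ.neg-antimono-< db<l))
                   (0<* 0<dr 0<dr))
  where open ℚ.+-*-Solver

-- The non-negative square root; by truncation √ p ≃ 0ℝ for p < 0.
√ : ℚ → ℝ
√ p = record
  { L           = Lo
  ; U           = Up
  ; L-inhabited = - 1ℚ , inj₁ -1<0
  ; U-inhabited = up
  ; L-rounded   = λ q → mk⇔ L-open L-down
  ; U-rounded   = λ r → mk⇔ U-open U-up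
  ; disjoint    = dis
  ; located     = loc
  }
  where
  Lo Up : ℚ → Set
  Lo q = q < 0ℚ ⊎ q * q < p
  Up r = 0ℚ < r × p < r * r

  up : ∃ Up
  up with p <? 1ℚ
  ... | yes p<1 = 1ℚ , 0<1 , p<1
  ... | no  p≮1 =
    let 1≤p   = ℚ.≮⇒≥ p≮1
        1<p+1 = ℚ.≤-<-trans 1≤p (p<p+1 p)
        0<p+1 = ℚ.<-trans 0<1 1<p+1
    in p + 1ℚ , 0<p+1 , ℚ.<-trans (p<p+1 p)
         (subst (_< (p + 1ℚ) * (p + 1ℚ)) (ℚ.*-identityʳ (p + 1ℚ))
           (ℚ.*-monoʳ-<-pos (p + 1ℚ) ⦃ positive 0<p+1 ⦄ 1<p+1))

  L-open : ∀ {q} → Lo q → ∃ λ r → q < r × Lo r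
  L-open (inj₁ q<0) = let (r , q<r , r<0) = ℚ.<-dense q<0 in r , q<r , inj₁ r<0
  L-open {q} (inj₂ qq<p) with q <? 0ℚ
  ... | yes q<0 = L-open (inj₁ q<0)
  ... | no  q≮0 = let (s , q<s , ss<p) = sq-above (ℚ.≮⇒≥ q≮0) qq<p
                  in s , q<s , inj₂ ss<p

  L-down : ∀ {q} → (∃ λ r → q < r × Lo r) → Lo q
  L-down (r , q<r , inj₁ r<0) = inj₁ (ℚ.<-trans q<r r<0)
  L-down {q} (r , q<r , inj₂ rr<p) with q <? 0ℚ
  ... | yes q<0 = inj₁ q<0
  ... | no  q≮0 = inj₂ (ℚ.<-trans (sq-mono-< (ℚ.≮⇒≥ q≮0) q<r) rr<p)

  U-open : ∀ {r} → Up r → ∃ λ q → q < r × Up q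
  U-open (0<r , p<rr) = sq-below 0<r p<rr

  U-up : ∀ {r} → (∃ λ q → q < r × Up q) → Up r
  U-up (q , q<r , 0<q , p<qq) =
    ℚ.<-trans 0<q q<r , ℚ.<-trans p<qq (sq-mono-< (ℚ.<⇒≤ 0<q) q<r)

  dis : ∀ q → Lo q → Up q → ⊥
  dis q (inj₁ q<0)  (0<q , _)    = ℚ.<-asym q<0 0<q
  dis q (inj₂ qq<p) (_   , p<qq) = ℚ.<-asym qq<p p<qq

  loc : ∀ q r → q < r → Lo q ⊎ Up r
  loc q r q<r with q <? 0ℚ
  ... | yes q<0 = inj₁ (inj₁ q<0)
  ... | no  q≮0 with q * q <? p
  ...   | yes qq<p = inj₁ (inj₂ qq<p)
  ...   | no  qq≮p =
    let 0≤q = ℚ.≮⇒≥ q≮0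
    in inj₂ (ℚ.≤-<-trans 0≤q q<r , ℚ.≤-<-trans (ℚ.≮⇒≥ qq≮p) (sq-mono-< 0≤q q<r))

infixr 7 _·_

-- Natural-number multiples n · x; for n > 0, q < n · x iff q / n < x.
_·_ : ℕ → ℝ → ℝ
zero    · x = 0ℝ
n@(suc _) · x = record
  { L           = λ q → L (q * k)
  ; U           = λ q → U (q * k)
  ; L-inhabited = let (s , Ls) = L-inhabited in s * N , subst L (sym (sNk s)) Ls
  ; U-inhabited = let (s , Us) = U-inhabited in s * N , subst U (sym (sNk s)) Us
  ; L-rounded   = λ q → mk⇔
      (λ Lq → let (s , qk<s , Ls) = Equivalence.to (L-rounded (q * k)) Lq
              in s * N , k-cancel (subst (q * k <_) (sym (sNk s)) qk<s)
               , subst L (sym (sNk s)) Ls)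
      (λ (r , q<r , Lr) → Equivalence.from (L-rounded (q * k))
                            (r * k , k-mono q<r , Lr))
  ; U-rounded   = λ r → mk⇔
      (λ Ur → let (s , s<rk , Us) = Equivalence.to (U-rounded (r * k)) Ur
              in s * N , k-cancel (subst (_< r * k) (sym (sNk s)) s<rk)
               , subst U (sym (sNk s)) Us)
      (λ (q , q<r , Uq) → Equivalence.from (U-rounded (r * k))
                            (q * k , k-mono q<r , Uq))
  ; disjoint    = λ q → disjoint (q * k)
  ; located     = λ q r q<r → located (q * k) (r * k) (k-mono q<r)
  }
  where
  open ℝ x
  N = ℤ.+ n / 1
  instance
    N-pos : Positive N
    N-pos = ℚ.normalize-pos n 1
    N-nonZero = ℚ.pos⇒nonZero N
  k = 1/ N
  instance
    k-pos : Positive k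
    k-pos = ℚ.1/pos⇒pos N
    k-nonNeg = ℚ.pos⇒nonNeg k
  sNk : ∀ s → (s * N) * k ≡ s
  sNk s = trans (ℚ.*-assoc s N k)
    (trans (cong (s *_) (ℚ.*-inverseʳ N)) (ℚ.*-identityʳ s))
  k-mono : ∀ {q r} → q < r → q * k < r * k
  k-mono = ℚ.*-monoˡ-<-pos k
  k-cancel : ∀ {q r} → q * k < r * k → q < r
  k-cancel = ℚ.*-cancelʳ-<-nonNeg k

------------------------------------------------------------------------
-- Coherent configurations

# : ∀ {n p} {P : Pred (Fin n) p} → Decidable P → ℕ
# {n} P? = length (filter P? (allFin n))

#-nonZero : ∀ {n p} {P : Pred (Fin n) p} (P? : Decidable P) {i} → P i →
            NonZero (# P?)
#-nonZero P? {i} Pi = ℕ.>-nonZero (filter-some P? (lose (∈-allFin i) Pi))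

private
  filter-nonempty : ∀ {n p} {P : Pred (Fin n) p} (P? : Decidable P) xs →
                    NonZero (length (filter P? xs)) → ∃ P
  filter-nonempty P? (x ∷ xs) nz with P? x
  ... | yes Px = x , Px
  ... | no  _  = filter-nonempty P? xs nz

#-nonZero⁻¹ : ∀ {n p} {P : Pred (Fin n) p} (P? : Decidable P) →
              NonZero (# P?) → ∃ P
#-nonZero⁻¹ P? = filter-nonempty P? (allFin _)

-- A partition of X × X into non-empty parts indexed by S is encoded as the
-- surjection sending each pair to (the index of) the part containing it:
-- a ∈ S stands for the relation {(x , y) | class x y ≡ a}.
record CoherentConfiguration : Set where
  field
    order rank : ℕ

  X : Set
  X = Fin order

  S : Set
  S = Fin rank

  field
    class    : X → X → S
    nonempty : ∀ a → ∃₂ λ x y → class x y ≡ a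
    diagonal : ∀ p x → class x x ≡ p → ∀ y z → class y z ≡ p → y ≡ z
    converse : ∀ c → ∃ λ c′ → ∀ x y → class x y ≡ c′ ⇔ class y x ≡ c

  via? : ∀ a b x y → Decidable (λ z → class x z ≡ a × class z y ≡ b)
  via? a b x y z = (class x z Fin.≟ a) ×-dec (class z y Fin.≟ b)

  field
    ∇       : S → S → S → ℕ
    ∇-count : ∀ a b c x y → class x y ≡ c → # (via? a b x y) ≡ ∇ a b c

  out? : ∀ a x → Decidable (λ y → class x y ≡ a)
  out? a x y = class x y Fin.≟ a

  -- Computed at a chosen x; ‖‖-count shows that the choice is immaterial.
  ‖_‖ : S → ℕ
  ‖ a ‖ = # (out? a (proj₁ (nonempty a)))

  ‖‖-nonZero : ∀ a → NonZero ‖ a ‖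
  ‖‖-nonZero a = let (x , y , xy∈a) = nonempty a in #-nonZero (out? a x) xy∈a

  ‖‖-count : ∀ a x y → class x y ≡ a → # (out? a x) ≡ ‖ a ‖
  ‖‖-count a x y xy∈a =
    trans (as-∇ x) (trans (cong (∇ a a*) same-source) (sym (as-∇ x₀)))
    where
    x₀ = proj₁ (nonempty a)
    x₀y₀∈a = proj₂ (proj₂ (nonempty a))
    a* = proj₁ (converse a)

    as-∇ : ∀ x → # (out? a x) ≡ ∇ a a* (class x x)
    as-∇ x = trans
      (cong length (filter-≐ (out? a x) (via? a a* x x)
        ( (λ {z} xz∈a → xz∈a
             , Equivalence.from (proj₂ (converse a) z x) xz∈a)
        , proj₁) (allFin order)))
      (∇-count a a* (class x x) x x refl)

    same-source : class x x ≡ class x₀ x₀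
    same-source =
      let 1ₓ = class x x
          (z , x₀z∈1ₓ , _) = #-nonZero⁻¹ (via? 1ₓ a x₀ _)
            (subst NonZero
              (trans (∇-count 1ₓ a a x y xy∈a) (sym (∇-count 1ₓ a a x₀ _ x₀y₀∈a)))
              (#-nonZero (via? 1ₓ a x y) (refl , xy∈a)))
          x₀≡z = diagonal 1ₓ x refl x₀ z x₀z∈1ₓ
      in sym (trans (cong (class x₀) x₀≡z) x₀z∈1ₓ)

  ∇̇ : S → S → S → ℝ
  ∇̇ a b c = ∇ a b c · √ (_/_ (ℤ.+ ‖ c ‖) (‖ a ‖ ℕ.* ‖ b ‖)
    ⦃ ℕ.m*n≢0 ‖ a ‖ ‖ b ‖ ⦃ ‖‖-nonZero a ⦄ ⦃ ‖‖-nonZero b ⦄ ⦄)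

  _⊆id : S → Set
  a ⊆id = ∀ x y → class x y ≡ a → x ≡ y

  _⊆id? : ∀ a → Dec (a ⊆id)
  a ⊆id? = Fin.all? λ x → Fin.all? λ y →
    (class x y Fin.≟ a) →-dec (x Fin.≟ y)

  e : S → ℝ
  e a = if does (a ⊆id?) then 1ℝ else 0ℝ

{-# OPTIONS --safe #-}
module Submission where

open import Defs
open import Data.Bool using (if_then_else_)
open import Data.Fin using (Fin; zero; suc)
import Data.Fin.Properties as Fin
import Data.Integer as ℤ
import Data.Integer.Properties as ℤ
open import Data.List using (length; filter; tabulate; allFin)
open import Data.List.Membership.Propositional.Properties using (∈-allFin)
open import Data.List.Properties using (filter-≐)
import Data.List.Relation.Unary.All as All
open import Data.Nat using (ℕ; zero; suc)
import Data.Nat as ℕ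
import Data.Nat.Properties as ℕ
import Data.Nat.Solver as ℕ
open import Data.Product using (∃; _×_; _,_; proj₁; proj₂)
open import Data.Rational using (0ℚ; 1ℚ; _/_)
import Data.Rational.Properties as ℚ
import Data.Rational.Solver as ℚ
import Data.Rational.Unnormalised as ℚᵘ
import Data.Rational.Unnormalised.Properties as ℚᵘ
open import Data.Sum using (inj₁; inj₂)
open import Function.Base using (_∘_; id)
open import Function.Bundles using (_⇔_; mk⇔; _⤖_; module Bijection; module Equivalence)
open import Function.Properties.Bijection using (⤖⇒↔)
open import Relation.Binary.PropositionalEquality
open import Relation.Nullary using (Dec; yes; no; does; contradiction)
open import Relation.Nullary.Decidable using (_×-dec_)
open import Relation.Unary using (Pred; Decidable)
open import Algebra.Properties.CommutativeMonoid.Sum ℕ.+-0-commutativeMonoid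
  using (sum; sum-cong-≗; ∑-comm; sum-permute; sum-replicate-zero)
open import Algebra.Properties.Semiring.Sum ℕ.+-*-semiring
  using (*-distribˡ-sum; *-distribʳ-sum)
open import Data.List.Extrema ℚᵘ.≤-totalOrder using (argmax; f[xs]≤f[argmax])

-- A square root is determined by the rationals below it, so ∇̇ determines
-- ∇² ‖c‖ / (‖a‖ ‖b‖).  Write r a = ‖θ a‖ / ‖a‖.  With b the converse of a and c
-- the diagonal class at the source of a, ∇ a b c = ‖a‖ and ∇ c c c = ‖c‖ on both
-- sides (e makes θ respect this situation), so r c = 1 and r a = r b.  Let r be
-- largest at m, let b be the converse of m, and compare ∑_c ∇ m b c ‖c‖ =
-- ‖m‖ ‖b‖ with its image under θ: since ∇′ ‖c‖′ = ∇ ‖c‖ · r m · √(r c), assuming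
-- r m > 1 makes every nonzero summand grow by a factor less than (r m)², whereas
-- the total grows by exactly (r m)².  Hence r ≤ 1, by symmetry r = 1, and ∇′² = ∇².

-- Square roots: recovering `n² p` from the cut of `n · √ p`.

module SquareRoots where
  open import Data.Rational hiding (_≃_)

  fromℚᵘ-homo-+ : ∀ p q → fromℚᵘ (p ℚᵘ.+ q) ≡ fromℚᵘ p + fromℚᵘ q
  fromℚᵘ-homo-+ p q = ℚ.toℚᵘ-injective
    (ℚᵘ.≃-trans (ℚ.toℚᵘ-fromℚᵘ (p ℚᵘ.+ q))
    (ℚᵘ.≃-trans (ℚᵘ.≃-sym (ℚᵘ.+-cong (ℚ.toℚᵘ-fromℚᵘ p) (ℚ.toℚᵘ-fromℚᵘ q)))
                (ℚᵘ.≃-sym (ℚ.toℚᵘ-homo-+ (fromℚᵘ p) (fromℚᵘ q)))))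

  fromℚᵘ-homo-* : ∀ p q → fromℚᵘ (p ℚᵘ.* q) ≡ fromℚᵘ p * fromℚᵘ q
  fromℚᵘ-homo-* p q = ℚ.toℚᵘ-injective
    (ℚᵘ.≃-trans (ℚ.toℚᵘ-fromℚᵘ (p ℚᵘ.* q))
    (ℚᵘ.≃-trans (ℚᵘ.≃-sym (ℚᵘ.*-cong (ℚ.toℚᵘ-fromℚᵘ p) (ℚ.toℚᵘ-fromℚᵘ q)))
                (ℚᵘ.≃-sym (ℚ.toℚᵘ-homo-* (fromℚᵘ p) (fromℚᵘ q)))))

  fromℕ : ℕ → ℚ
  fromℕ n = ℤ.+ n / 1

  fromℕ-suc : ∀ n → fromℕ (suc n) ≡ fromℕ n + 1ℚ
  fromℕ-suc n = trans
    (ℚ.fromℚᵘ-cong {ℚᵘ.mkℚᵘ (ℤ.+ suc n) 0} {ℚᵘ.mkℚᵘ (ℤ.+ n) 0 ℚᵘ.+ ℚᵘ.1ℚᵘ}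
      (ℚᵘ.*≡* (cong (ℤ._* ℤ.1ℤ) (begin
      ℤ.+ suc n                    ≡⟨ cong ℤ.+_ (ℕ.+-comm 1 n) ⟩
      ℤ.+ n ℤ.+ ℤ.1ℤ               ≡⟨ cong (ℤ._+ ℤ.1ℤ) (ℤ.*-identityʳ (ℤ.+ n)) ⟨
      ℤ.+ n ℤ.* ℤ.1ℤ ℤ.+ ℤ.1ℤ      ∎))))
    (fromℚᵘ-homo-+ (ℚᵘ.mkℚᵘ (ℤ.+ n) 0) ℚᵘ.1ℚᵘ)
    where open ≡-Reasoning

  0≤fromℕ : ∀ n → 0ℚ ≤ fromℕ n
  0≤fromℕ n = ℚ.nonNegative⁻¹ (fromℕ n) ⦃ ℚ.normalize-nonNeg n 1 ⦄

  <-fromℕ : ∀ p → ∃ λ n → p < fromℕ n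
  <-fromℕ p@(mkℚ i d-1 _) = n , ℚ.toℚᵘ-cancel-<
      (ℚᵘ.<-respʳ-≃ (ℚᵘ.≃-sym (ℚ.toℚᵘ-fromℚᵘ (ℚᵘ.mkℚᵘ (ℤ.+ n) 0)))
        (ℚᵘ.*<* (begin-strict
          i ℤ.* ℤ.1ℤ               ≡⟨ ℤ.*-identityʳ i ⟩
          i                        ≤⟨ i≤∣i∣ i ⟩
          ℤ.+ ℤ.∣ i ∣              <⟨ ℤ.+<+ ℕ.≤-refl ⟩
          ℤ.+ n                    ≤⟨ ℤ.+≤+ (ℕ.m≤m*n n (suc d-1)) ⟩
          ℤ.+ (n ℕ.* suc d-1)      ≡⟨ ℤ.pos-* n (suc d-1) ⟩
          ℤ.+ n ℤ.* ℤ.+ suc d-1    ∎)))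
    where
    open ℤ.≤-Reasoning
    -- Exceeds the numerator of `p`, hence `p` itself, as the denominator is at least 1.
    n = suc ℤ.∣ i ∣
    i≤∣i∣ : ∀ i → i ℤ.≤ ℤ.+ ℤ.∣ i ∣
    i≤∣i∣ (ℤ.+ _)    = ℤ.≤-refl
    i≤∣i∣ ℤ.-[1+ _ ] = ℤ.-≤+

  archimedean : ∀ {d} → 0ℚ < d → ∀ p → ∃ λ n → p < fromℕ n * d
  archimedean {d} 0<d p =
    let (n , p/d<n) = <-fromℕ (p * 1/ d)
    in n , subst (_< fromℕ n * d)
         (trans (ℚ.*-assoc p (1/ d) d)
           (trans (cong (p *_) (ℚ.*-inverseˡ d)) (ℚ.*-identityʳ p)))
         (ℚ.*-monoˡ-<-pos d p/d<n)
    where instance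
      d-pos : Positive d
      d-pos = positive 0<d
      d-nonZero : NonZero d
      d-nonZero = ℚ.pos⇒nonZero d

  sq-cancel-< : ∀ {q r} → 0ℚ ≤ r → q * q < r * r → q < r
  sq-cancel-< {q} {r} 0≤r qq<rr with q <? r
  ... | yes q<r = q<r
  ... | no  q≮r = contradiction (ℚ.<-≤-trans qq<rr rr≤qq) (ℚ.<-irrefl refl)
    where
    r≤q = ℚ.≮⇒≥ q≮r
    rr≤qq = ℚ.≤-trans (ℚ.*-monoˡ-≤-nonNeg r ⦃ nonNegative 0≤r ⦄ r≤q)
              (ℚ.*-monoʳ-≤-nonNeg q ⦃ nonNegative (ℚ.≤-trans 0≤r r≤q) ⦄ r≤q)

  -- If y < x, the hypothesis makes {q ≥ 0 | q² < y} closed under q ↦ q + d for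
  -- a fixed d > 0 (chosen so that q² < y gives (q + d)² < x), which is absurd
  -- since ℚ is Archimedean and the set is bounded.
  squares-below⇒≤ : ∀ {x y} → 0ℚ ≤ y →
    (∀ q → 0ℚ ≤ q → q * q < x → q * q < y) → x ≤ y
  squares-below⇒≤ {x} {y} 0≤y x⊆y with y <? x
  ... | no  y≮x = ℚ.≮⇒≥ y≮x
  ... | yes y<x = contradiction (ℚ.<-trans (grid<B n) B<nd) (ℚ.<-irrefl refl)
    where
    open ℚ.+-*-Solver
    -- A rational `B > 0` with `y < B²`, read off from the upper half of the cut.
    upper = ℝ.U-inhabited (√ y)
    B     = proj₁ upper
    0<B   = proj₁ (proj₂ upper)
    y<BB  = proj₂ (proj₂ upper)
    -- For `q < B` and `d < 1`, `(q + d)² - q² = d (2q + d) < d (2B + 1)`, and `small` keeps the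
    -- latter below `x - y`.
    step  = small (0<r-p y<x)
      (ℚ.+-mono-≤ (ℚ.+-mono-≤ (ℚ.<⇒≤ 0<B) (ℚ.<⇒≤ 0<B)) (ℚ.nonNegative⁻¹ 1ℚ))
    d    = proj₁ step
    0<d  = proj₁ (proj₂ step)
    d<1  = proj₁ (proj₂ (proj₂ step))
    db<l = proj₂ (proj₂ (proj₂ step))

    bounded : ∀ {q} → q * q < y → q < B
    bounded qq<y = sq-cancel-< (ℚ.<⇒≤ 0<B) (ℚ.<-trans qq<y y<BB)

    shift : ∀ {q} → 0ℚ ≤ q → q * q < y → (q + d) * (q + d) < y
    shift {q} 0≤q qq<y = let q<B = bounded {q} qq<y in x⊆y (q + d) (ℚ.+-mono-≤ 0≤q (ℚ.<⇒≤ 0<d))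
      (subst₂ _<_
        (solve 2 (λ q d → q :* q :+ d :* ((q :+ q) :+ d)
                       := (q :+ d) :* (q :+ d)) refl q d)
        (solve 2 (λ x y → y :+ (x :- y) := x) refl x y)
        (ℚ.+-mono-< qq<y (ℚ.<-trans
          (ℚ.*-monoʳ-<-pos d ⦃ positive 0<d ⦄
            (ℚ.+-mono-< (ℚ.+-mono-< q<B q<B) d<1))
          db<l)))

    0≤nd : ∀ n → 0ℚ ≤ fromℕ n * d
    0≤nd n = subst (_≤ fromℕ n * d) (ℚ.*-zeroˡ d)
      (ℚ.*-monoʳ-≤-nonNeg d ⦃ nonNegative (ℚ.<⇒≤ 0<d) ⦄ (0≤fromℕ n))

    grid : ∀ n → (fromℕ n * d) * (fromℕ n * d) < y
    grid zero = subst (λ q → q * q < y) (sym (ℚ.*-zeroˡ d))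
      (x⊆y 0ℚ ℚ.≤-refl (ℚ.≤-<-trans 0≤y y<x))
    grid (suc n) = subst (λ q → q * q < y)
      (trans (solve 2 (λ m d → m :* d :+ d := (m :+ con 1ℚ) :* d) refl (fromℕ n) d)
             (cong (_* d) (sym (fromℕ-suc n))))
      (shift (0≤nd n) (grid n))

    grid<B : ∀ n → fromℕ n * d < B
    grid<B n = bounded (grid n)

    n    = proj₁ (archimedean 0<d B)
    B<nd = proj₂ (archimedean 0<d B)

  -- For `n > 0` the lower cut at `q` says `q / n < 0`, impossible for `q ≥ 0`, or `(q / n)² < p`;
  -- multiply by `n²`. For `n = 0` both sides are false.
  L-·√ : ∀ n p q → 0ℚ ≤ q →
         ℝ.L (n · √ p) q ⇔ q * q < (fromℕ n * fromℕ n) * p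
  L-·√ zero p q 0≤q = mk⇔
    (λ q<0 → contradiction (ℚ.<-≤-trans q<0 0≤q) (ℚ.<-irrefl refl))
    (λ qq<0 → sq-cancel-< ℚ.≤-refl (subst (q * q <_) (ℚ.*-zeroˡ p) qq<0))
  L-·√ n@(suc _) p q 0≤q = mk⇔
    (λ { (inj₁ qk<0) → contradiction
           (ℚ.<-≤-trans (ℚ.*-cancelʳ-<-nonNeg k
             (subst (q * k <_) (sym (ℚ.*-zeroˡ k)) qk<0)) 0≤q)
           (ℚ.<-irrefl refl)
       ; (inj₂ qkqk<p) → subst (_< (N * N) * p) unscale
           (ℚ.*-monoʳ-<-pos (N * N) qkqk<p) })
    (λ qq<NNp → inj₂ (ℚ.*-cancelˡ-<-nonNeg (N * N)
           (subst (_< (N * N) * p) (sym unscale) qq<NNp)))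
    where
    N = fromℕ n
    instance
      N-pos : Positive N
      N-pos = ℚ.normalize-pos n 1
      N-nonZero : NonZero N
      N-nonZero = ℚ.pos⇒nonZero N
      NN-pos : Positive (N * N)
      NN-pos = ℚ.pos*pos⇒pos N N
      NN-nonNeg : NonNegative (N * N)
      NN-nonNeg = ℚ.pos⇒nonNeg (N * N)
    k = 1/ N
    instance
      k-nonNeg : NonNegative k
      k-nonNeg = ℚ.pos⇒nonNeg k ⦃ ℚ.1/pos⇒pos N ⦄
    unscale : (N * N) * ((q * k) * (q * k)) ≡ q * q
    unscale = trans
      (solve 3 (λ N k q → (N :* N) :* ((q :* k) :* (q :* k))
                       := (q :* q) :* ((N :* k) :* (N :* k))) refl N k q)
      (trans (cong (λ i → (q * q) * (i * i)) (ℚ.*-inverseʳ N)) (ℚ.*-identityʳ (q * q)))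
      where open ℚ.+-*-Solver

  -- `L-·√` turns `≃` into the hypothesis of `squares-below⇒≤`.
  ·√-square-≤ : ∀ n p m q → 0ℚ ≤ q → n · √ p ≃ m · √ q →
                (fromℕ n * fromℕ n) * p ≤ (fromℕ m * fromℕ m) * q
  ·√-square-≤ n p m q 0≤q eq = squares-below⇒≤
    (ℚ.nonNegative⁻¹ ((M * M) * q)
      ⦃ ℚ.nonNeg*nonNeg⇒nonNeg (M * M) ⦃ ℚ.nonNeg*nonNeg⇒nonNeg M M ⦄ q ⦄)
    (λ r 0≤r below → Equivalence.to (L-·√ m q r 0≤r)
      (Equivalence.to (proj₁ (eq r)) (Equivalence.from (L-·√ n p r 0≤r) below)))
    where
    M = fromℕ m
    instance
      M-nonNeg : NonNegative M
      M-nonNeg = nonNegative (0≤fromℕ m)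
      q-nonNeg : NonNegative q
      q-nonNeg = nonNegative 0≤q

  ·√-square : ∀ {n p m q} → 0ℚ ≤ p → 0ℚ ≤ q → n · √ p ≃ m · √ q →
              (fromℕ n * fromℕ n) * p ≡ (fromℕ m * fromℕ m) * q
  ·√-square {n} {p} {m} {q} 0≤p 0≤q eq = ℚ.≤-antisym
    (·√-square-≤ n p m q 0≤q eq)
    (·√-square-≤ m q n p 0≤p λ r →
        mk⇔ (Equivalence.from (proj₁ (eq r))) (Equivalence.to (proj₁ (eq r)))
      , mk⇔ (Equivalence.from (proj₂ (eq r))) (Equivalence.to (proj₂ (eq r))))

  -- Clears denominators in `·√-square`, passing through `ℚᵘ`, where equality is cross
  -- multiplication. The radicands are variables with equations so that opaque ones can be supplied.
  ·√-/-square : ∀ {n m p q c c′ d d′} .⦃ _ : ℕ.NonZero d ⦄ .⦃ _ : ℕ.NonZero d′ ⦄ →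
    p ≡ ℤ.+ c / d → q ≡ ℤ.+ c′ / d′ → n · √ p ≃ m · √ q →
    n ℕ.* n ℕ.* c ℕ.* d′ ≡ m ℕ.* m ℕ.* c′ ℕ.* d
  ·√-/-square {n} {m} {p} {q} {c} {c′} {d@(suc d-1)} {d′@(suc d′-1)} p≡ q≡ eq =
    clear (ℚ.fromℚᵘ-injective scaled-equal)
    where
    open ≡-Reasoning

    nonneg : ∀ c d .⦃ _ : ℕ.NonZero d ⦄ → 0ℚ ≤ ℤ.+ c / d
    nonneg c d = ℚ.nonNegative⁻¹ (ℤ.+ c / d) ⦃ ℚ.normalize-nonNeg c d ⦄

    scaled : ℕ → ℕ → ℕ → ℚᵘ.ℚᵘ
    scaled n c d-1 =
      (ℚᵘ.mkℚᵘ (ℤ.+ n) 0 ℚᵘ.* ℚᵘ.mkℚᵘ (ℤ.+ n) 0) ℚᵘ.* ℚᵘ.mkℚᵘ (ℤ.+ c) d-1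

    fromℚᵘ-scaled : ∀ n c d-1 → fromℚᵘ (scaled n c d-1) ≡
                    (fromℕ n * fromℕ n) * (ℤ.+ c / suc d-1)
    fromℚᵘ-scaled n c d-1 = trans
      (fromℚᵘ-homo-* (ℚᵘ.mkℚᵘ (ℤ.+ n) 0 ℚᵘ.* ℚᵘ.mkℚᵘ (ℤ.+ n) 0) (ℚᵘ.mkℚᵘ (ℤ.+ c) d-1))
      (cong (_* (ℤ.+ c / suc d-1))
        (fromℚᵘ-homo-* (ℚᵘ.mkℚᵘ (ℤ.+ n) 0) (ℚᵘ.mkℚᵘ (ℤ.+ n) 0)))

    numerator : ∀ n c d → (ℤ.+ n ℤ.* ℤ.+ n ℤ.* ℤ.+ c) ℤ.* ℤ.+ d ≡
                          ℤ.+ (n ℕ.* n ℕ.* c ℕ.* d)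
    numerator n c d = sym (trans (ℤ.pos-* (n ℕ.* n ℕ.* c) d) (cong (ℤ._* ℤ.+ d)
      (trans (ℤ.pos-* (n ℕ.* n) c) (cong (ℤ._* ℤ.+ c) (ℤ.pos-* n n)))))

    clear : scaled n c d-1 ℚᵘ.≃ scaled m c′ d′-1 →
            n ℕ.* n ℕ.* c ℕ.* d′ ≡ m ℕ.* m ℕ.* c′ ℕ.* d
    clear (ℚᵘ.*≡* e) = ℤ.+-injective (begin
      ℤ.+ (n ℕ.* n ℕ.* c ℕ.* d′)   ≡⟨ numerator n c d′ ⟨
      (ℤ.+ n ℤ.* ℤ.+ n ℤ.* ℤ.+ c) ℤ.* ℤ.+ d′
        ≡⟨ cong (λ i → (ℤ.+ n ℤ.* ℤ.+ n ℤ.* ℤ.+ c) ℤ.* ℤ.+ i) (ℕ.*-identityˡ d′) ⟨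
      (ℤ.+ n ℤ.* ℤ.+ n ℤ.* ℤ.+ c) ℤ.* ℤ.+ (1 ℕ.* d′)  ≡⟨ e ⟩
      (ℤ.+ m ℤ.* ℤ.+ m ℤ.* ℤ.+ c′) ℤ.* ℤ.+ (1 ℕ.* d)
        ≡⟨ cong (λ i → (ℤ.+ m ℤ.* ℤ.+ m ℤ.* ℤ.+ c′) ℤ.* ℤ.+ i) (ℕ.*-identityˡ d) ⟩
      (ℤ.+ m ℤ.* ℤ.+ m ℤ.* ℤ.+ c′) ℤ.* ℤ.+ d  ≡⟨ numerator m c′ d ⟩
      ℤ.+ (m ℕ.* m ℕ.* c′ ℕ.* d)   ∎)

    squares : (fromℕ n * fromℕ n) * p ≡ (fromℕ m * fromℕ m) * q
    squares = ·√-square {n} {p} {m} {q}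
      (subst (0ℚ ≤_) (sym p≡) (nonneg c d)) (subst (0ℚ ≤_) (sym q≡) (nonneg c′ d′)) eq

    scaled-equal : fromℚᵘ (scaled n c d-1) ≡ fromℚᵘ (scaled m c′ d′-1)
    scaled-equal = begin
      fromℚᵘ (scaled n c d-1)              ≡⟨ fromℚᵘ-scaled n c d-1 ⟩
      (fromℕ n * fromℕ n) * (ℤ.+ c / d)    ≡⟨ cong ((fromℕ n * fromℕ n) *_) p≡ ⟨
      (fromℕ n * fromℕ n) * p              ≡⟨ squares ⟩
      (fromℕ m * fromℕ m) * q              ≡⟨ cong ((fromℕ m * fromℕ m) *_) q≡ ⟩
      (fromℕ m * fromℕ m) * (ℤ.+ c′ / d′)  ≡⟨ fromℚᵘ-scaled m c′ d′-1 ⟨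
      fromℚᵘ (scaled m c′ d′-1)            ∎

open SquareRoots using (·√-/-square)
open import Data.Nat using (NonZero; _+_; _*_; _≤_; _<_)

-- Finite sums and counting by indicators.

sum-mono-≤ : ∀ {n} {f g : Fin n → ℕ} → (∀ i → f i ≤ g i) → sum f ≤ sum g
sum-mono-≤ {zero}  f≤g = ℕ.z≤n
sum-mono-≤ {suc n} f≤g = ℕ.+-mono-≤ (f≤g zero) (sum-mono-≤ (f≤g ∘ suc))

sum-mono-< : ∀ {n} {f g : Fin n → ℕ} → (∀ i → f i ≤ g i) →
             ∀ {i} → f i < g i → sum f < sum g
sum-mono-< f≤g {zero}  fi<gi = ℕ.+-mono-<-≤ fi<gi (sum-mono-≤ (f≤g ∘ suc))
sum-mono-< f≤g {suc i} fi<gi = ℕ.+-mono-≤-< (f≤g zero) (sum-mono-< (f≤g ∘ suc) fi<gi)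

𝟙 : ∀ {p} {P : Set p} → Dec P → ℕ
𝟙 P? = if does P? then 1 else 0

#≡sum : ∀ {n p} {P : Pred (Fin n) p} (P? : Decidable P) → # P? ≡ sum (𝟙 ∘ P?)
#≡sum P? = tabulated P? id
  where
  -- `allFin` is `tabulate id`, but its tail is tabulated by another function, so the induction
  -- needs `f` arbitrary.
  tabulated : ∀ {m n p} {P : Pred (Fin n) p} (P? : Decidable P) (f : Fin m → Fin n) →
              length (filter P? (tabulate f)) ≡ sum (𝟙 ∘ P? ∘ f)
  tabulated {zero}  P? f = refl
  tabulated {suc m} P? f with P? (f zero)
  ... | yes _ = cong suc (tabulated P? (f ∘ suc))
  ... | no  _ = tabulated P? (f ∘ suc)

#-cong : ∀ {n p q} {P : Pred (Fin n) p} {Q : Pred (Fin n) q}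
         (P? : Decidable P) (Q? : Decidable Q) →
         (∀ {i} → P i → Q i) → (∀ {i} → Q i → P i) → # P? ≡ # Q?
#-cong P? Q? P⊆Q Q⊆P = cong length (filter-≐ P? Q? (P⊆Q , Q⊆P) (allFin _))

𝟙-× : ∀ {p q} {P : Set p} {Q : Set q} (P? : Dec P) (Q? : Dec Q) →
      𝟙 (P? ×-dec Q?) ≡ 𝟙 P? * 𝟙 Q?
𝟙-× (yes _) (yes _) = refl
𝟙-× (yes _) (no  _) = refl
𝟙-× (no  _) Q?      = refl

𝟙-*-cong : ∀ {p} {P : Set p} (P? : Dec P) {m n} → (P → m ≡ n) → 𝟙 P? * m ≡ 𝟙 P? * n
𝟙-*-cong (yes p) eq = cong (1 *_) (eq p)
𝟙-*-cong (no  _) eq = refl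

sum-δ : ∀ {n} (f : Fin n → ℕ) j → sum (λ i → f i * 𝟙 (j Fin.≟ i)) ≡ f j
sum-δ {suc n} f zero = trans
  (cong₂ _+_ (ℕ.*-identityʳ (f zero))
    (trans (sum-cong-≗ λ i → ℕ.*-zeroʳ (f (suc i))) (sum-replicate-zero n)))
  (ℕ.+-identityʳ (f zero))
sum-δ {suc n} f (suc j) = cong₂ _+_ (ℕ.*-zeroʳ (f zero)) (sum-δ (f ∘ suc) j)

*-congˡ-nonZero : ∀ {m n o} → (NonZero m → n ≡ o) → m * n ≡ m * o
*-congˡ-nonZero {zero}  eq = refl
*-congˡ-nonZero {m@(suc _)} eq = cong (m *_) (eq _)

-- Valencies and path counts in one configuration.

module Valency (C : CoherentConfiguration) where
  open CoherentConfiguration C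

  -- Kept abstract because comparing two such square roots by conversion makes
  -- Agda unfold the cuts and the normalisation of the radicand.
  abstract
    ∇̇-√ : ∀ a b c → ∃ λ p → ∇̇ a b c ≡ ∇ a b c · √ p
    ∇̇-√ a b c = _ , refl

    ∇̇-√-radicand : ∀ a b c → proj₁ (∇̇-√ a b c) ≡
      _/_ (ℤ.+ ‖ c ‖) (‖ a ‖ * ‖ b ‖)
        ⦃ ℕ.m*n≢0 ‖ a ‖ ‖ b ‖ ⦃ ‖‖-nonZero a ⦄ ⦃ ‖‖-nonZero b ⦄ ⦄
    ∇̇-√-radicand a b c = refl

  -- Both sides are the index that `converse` assigns to the common class.
  converse-unique : ∀ {x y x′ y′} → class x y ≡ class x′ y′ → class y x ≡ class y′ x′
  converse-unique {x} {y} {x′} {y′} eq =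
    trans (sym (back x y eq)) (back x′ y′ refl)
    where
    c* = converse (class x′ y′)
    back : ∀ u v → class u v ≡ class x′ y′ → proj₁ c* ≡ class v u
    back u v uv = sym (Equivalence.from (proj₂ c* v u) uv)

  -- With `a` the common class, the path `x → x → y` is counted by `∇ 1ₓ a a`. So some path
  -- `x′ → z → y′` starts in `1ₓ`, and `diagonal` forces `z = x′`.
  same-source : ∀ {x y x′ y′} → class x y ≡ class x′ y′ → class x x ≡ class x′ x′
  same-source {x} {y} {x′} {y′} eq =
    let 1ₓ = class x x
        (z , x′z∈1ₓ , _) = #-nonZero⁻¹ (via? 1ₓ (class x y) x′ y′)
          (subst NonZero
            (trans (∇-count 1ₓ (class x y) (class x y) x y refl)
                   (sym (∇-count 1ₓ (class x y) (class x y) x′ y′ (sym eq))))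
            (#-nonZero (via? 1ₓ (class x y) x y) {x} (refl , refl)))
        x′≡z = diagonal 1ₓ x refl x′ z x′z∈1ₓ
    in sym (trans (cong (class x′) x′≡z) x′z∈1ₓ)

  -- A `z` with `class x z = class x y` returns to `x` through the converse class automatically, so
  -- the paths counted are just out-neighbours.
  ∇-diagonal : ∀ x y → ∇ (class x y) (class y x) (class x x) ≡ ‖ class x y ‖
  ∇-diagonal x y = trans
    (sym (∇-count (class x y) (class y x) (class x x) x x refl))
    (trans (#-cong (via? (class x y) (class y x) x x) (out? (class x y) x)
              proj₁ (λ xz∈a → xz∈a , converse-unique xz∈a))
           (‖‖-count (class x y) x y refl))

  ∇-nonZero⇒path : ∀ {a b} x y → NonZero (∇ a b (class x y)) →
                   ∃ λ z → class x z ≡ a × class z y ≡ b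
  ∇-nonZero⇒path {a} {b} x y nz = #-nonZero⁻¹ (via? a b x y)
    (subst NonZero (sym (∇-count a b (class x y) x y refl)) nz)

  -- `‖‖-count` applies only at points where the class starts. It does start at `x`, because the
  -- nonzero count in `∇-diagonal` depends only on the diagonal class, which `x` and `x′` share.
  same-source-out : ∀ {x x′} y′ → class x x ≡ class x′ x′ →
                    # (out? (class x′ y′) x) ≡ ‖ class x′ y′ ‖
  same-source-out {x} {x′} y′ eq =
    let (w , xw∈c , _) = ∇-nonZero⇒path {class x′ y′} {class y′ x′} x x
          (subst NonZero (trans (sym (∇-diagonal x′ y′)) (cong (∇ _ _) (sym eq)))
            (‖‖-nonZero (class x′ y′)))
    in ‖‖-count (class x′ y′) x w xw∈c

  -- A class `c` not starting at `x` has positive valency but no out-neighbours there. For such `c`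
  -- the factor `∇` vanishes, since a path witnessing `∇ ≠ 0` gives `c` the same source as
  -- `class x y`.
  ∇*‖‖ : ∀ x y b c → ∇ (class x y) b c * ‖ c ‖ ≡ ∇ (class x y) b c * # (out? c x)
  ∇*‖‖ x y b c = let (x′ , y′ , x′y′∈c) = nonempty c in
    subst (λ c → ∇ (class x y) b c * ‖ c ‖ ≡ ∇ (class x y) b c * # (out? c x)) x′y′∈c
      (*-congˡ-nonZero λ nz →
        let (z , x′z≡xy , _) = ∇-nonZero⇒path x′ y′ nz
        in sym (same-source-out y′ (same-source (sym x′z≡xy))))

  -- Double counting of paths `x → w → z` with steps in `a` and `b`: grouped by the class of
  -- `(x , z)` on the left, by `w` on the right.
  ∑∇‖‖ : ∀ x y → let a = class x y; b = class y x in
         sum (λ c → ∇ a b c * ‖ c ‖) ≡ ‖ a ‖ * ‖ b ‖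
  ∑∇‖‖ x y = begin
    sum (λ c → ∇ a b c * ‖ c ‖)
      ≡⟨ sum-cong-≗ (λ c → trans (∇*‖‖ x y b c)
           (cong (∇ a b c *_) (#≡sum (out? c x)))) ⟩
    sum (λ c → ∇ a b c * sum (λ z → 𝟙 (class x z Fin.≟ c)))
      ≡⟨ sum-cong-≗ (λ c → *-distribˡ-sum (∇ a b c) (λ z → 𝟙 (class x z Fin.≟ c))) ⟩
    sum (λ c → sum (λ z → ∇ a b c * 𝟙 (class x z Fin.≟ c)))
      ≡⟨ ∑-comm (λ c z → ∇ a b c * 𝟙 (class x z Fin.≟ c)) ⟩
    sum (λ z → sum (λ c → ∇ a b c * 𝟙 (class x z Fin.≟ c)))
      ≡⟨ sum-cong-≗ (λ z → sum-δ (∇ a b) (class x z)) ⟩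
    sum (λ z → ∇ a b (class x z))
      ≡⟨ sum-cong-≗ (λ z → trans (sym (∇-count a b (class x z) x z refl))
           (#≡sum (via? a b x z))) ⟩
    sum (λ z → sum (λ w → 𝟙 (via? a b x z w)))
      ≡⟨ ∑-comm (λ z w → 𝟙 (via? a b x z w)) ⟩
    sum (λ w → sum (λ z → 𝟙 (via? a b x z w)))
      ≡⟨ sum-cong-≗ (λ w → trans
           (sum-cong-≗ λ z → 𝟙-× (class x w Fin.≟ a) (class w z Fin.≟ b))
           (sym (*-distribˡ-sum (𝟙 (class x w Fin.≟ a)) (λ z → 𝟙 (class w z Fin.≟ b))))) ⟩
    sum (λ w → 𝟙 (class x w Fin.≟ a) * sum (λ z → 𝟙 (class w z Fin.≟ b)))
      -- If `(x , w)` is in `a` then `(w , x)` is in `b`, so `b` starts at `w` and its valency may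
      -- be counted there.
      ≡⟨ sum-cong-≗ (λ w → 𝟙-*-cong (class x w Fin.≟ a) λ xw∈a →
           trans (sym (#≡sum (out? b w))) (‖‖-count b w x (converse-unique xw∈a))) ⟩
    sum (λ w → 𝟙 (class x w Fin.≟ a) * ‖ b ‖)
      ≡⟨ *-distribʳ-sum ‖ b ‖ (λ w → 𝟙 (class x w Fin.≟ a)) ⟨
    sum (λ w → 𝟙 (class x w Fin.≟ a)) * ‖ b ‖
      ≡⟨ cong (_* ‖ b ‖) (trans (sym (#≡sum (out? a x))) (‖‖-count a x y refl)) ⟩
    ‖ a ‖ * ‖ b ‖ ∎
    where
    open ≡-Reasoning
    a = class x y
    b = class y x

-- Comparing valencies at the maximal ratio, within `ℕ`.

square-cancel-≤ : ∀ {m n} → m * m ≤ n * n → m ≤ n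
square-cancel-≤ mm≤nn = ℕ.≮⇒≥ λ n<m → ℕ.<⇒≱ (ℕ.*-mono-< n<m n<m) mm≤nn

square-cancel-< : ∀ {m n} → m * m < n * n → m < n
square-cancel-< mm<nn = ℕ.≰⇒> λ n≤m → ℕ.<⇒≱ mm<nn (ℕ.*-mono-≤ n≤m n≤m)

square-injective : ∀ {m n} → m * m ≡ n * n → m ≡ n
square-injective mm≡nn = ℕ.≤-antisym
  (square-cancel-≤ (ℕ.≤-reflexive mm≡nn)) (square-cancel-≤ (ℕ.≤-reflexive (sym mm≡nn)))

/-≤⇒*-≤ : ∀ {a b c d} .⦃ _ : NonZero b ⦄ .⦃ _ : NonZero d ⦄ →
          (ℤ.+ a) ℚᵘ./ b ℚᵘ.≤ (ℤ.+ c) ℚᵘ./ d → a * d ≤ c * b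
/-≤⇒*-≤ {a} {b@(suc _)} {c} {d@(suc _)} (ℚᵘ.*≤* le) =
  ℤ.drop‿+≤+ (subst₂ ℤ._≤_ (sym (ℤ.pos-* a d)) (sym (ℤ.pos-* c b)) le)

-- Maximises the fraction `p i / q i`. The argument `i₀` is the default of `argmax` and witnesses
-- that `Fin k` is inhabited.
max-ratio : ∀ {k} (p q : Fin k → ℕ) ⦃ _ : ∀ {i} → NonZero (q i) ⦄ → Fin k →
            ∃ λ m → ∀ i → p i * q m ≤ p m * q i
max-ratio {k} p q i₀ = m , λ i →
  /-≤⇒*-≤ (All.lookup (f[xs]≤f[argmax] {f = ratio} i₀ (allFin k)) (∈-allFin i))
  where
  ratio = λ i → (ℤ.+ p i) ℚᵘ./ q i
  m = argmax ratio i₀ (allFin k)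

-- The summand at c of the comparison of ∑_c ∇ m b c ‖c‖ with its image, where
-- t = ∇ m b c, n = ‖c‖, q = ‖m‖, q₁ = ‖b‖; primes and p, p₁ refer to the image.
module _ {t′ t n′ n p q p₁ q₁ : ℕ} ⦃ _ : NonZero q₁ ⦄
  (eq : t′ * t′ * n′ * (q * q₁) ≡ t * t * n * (p * p₁))
  (n′q≤pn : n′ * q ≤ p * n) (q<p : q < p) (pq₁≡qp₁ : p * q₁ ≡ q * p₁)
  where
  open ℕ.+-*-Solver

  private
    -- The right-hand side of `term-≤` has square `K * p₁`, the left-hand side has square at most
    -- `K * q₁`; what remains is `q₁ < p₁`.
    K = t * t * (n * n) * (p * p) * p₁

    q₁<p₁ : q₁ < p₁
    q₁<p₁ = ℕ.≰⇒> λ p₁≤q₁ → ℕ.<-irrefl (sym pq₁≡qp₁)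
      (ℕ.≤-<-trans (ℕ.*-monoʳ-≤ q p₁≤q₁) (ℕ.*-monoˡ-< q₁ q<p))

    square-≤ : t′ * n′ * (q * q₁) * (t′ * n′ * (q * q₁)) ≤ K * q₁
    square-≤ = begin
      t′ * n′ * (q * q₁) * (t′ * n′ * (q * q₁))
        ≡⟨ solve 4 (λ t n q r → t :* n :* (q :* r) :* (t :* n :* (q :* r))
             := (t :* t :* n :* (q :* r)) :* r :* (n :* q)) refl t′ n′ q q₁ ⟩
      t′ * t′ * n′ * (q * q₁) * q₁ * (n′ * q)  ≡⟨ cong (λ s → s * q₁ * (n′ * q)) eq ⟩
      t * t * n * (p * p₁) * q₁ * (n′ * q)     ≤⟨ ℕ.*-monoʳ-≤ (t * t * n * (p * p₁) * q₁) n′q≤pn ⟩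
      t * t * n * (p * p₁) * q₁ * (p * n)
        ≡⟨ solve 5 (λ t n p s r → t :* t :* n :* (p :* s) :* r :* (p :* n)
             := t :* t :* (n :* n) :* (p :* p) :* s :* r) refl t n p p₁ q₁ ⟩
      K * q₁ ∎
      where open ℕ.≤-Reasoning

    K*p₁ : K * p₁ ≡ t * n * (p * p₁) * (t * n * (p * p₁))
    K*p₁ = solve 4 (λ t n p s → t :* t :* (n :* n) :* (p :* p) :* s :* s
      := t :* n :* (p :* s) :* (t :* n :* (p :* s))) refl t n p p₁

  term-≤ : t′ * n′ * (q * q₁) ≤ t * n * (p * p₁)
  term-≤ = square-cancel-≤ (ℕ.≤-trans square-≤
    (subst (K * q₁ ≤_) K*p₁ (ℕ.*-monoʳ-≤ K (ℕ.<⇒≤ q₁<p₁))))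

  -- Strict because nonzero `t` and `n` make `K` nonzero.
  term-< : ⦃ _ : NonZero t ⦄ ⦃ _ : NonZero n ⦄ → t′ * n′ * (q * q₁) < t * n * (p * p₁)
  term-< = square-cancel-< (ℕ.≤-<-trans square-≤
    (subst (K * q₁ <_) K*p₁ (ℕ.*-monoʳ-< K q₁<p₁)))
    where instance
      p≢0 : NonZero p
      p≢0 = ℕ.>-nonZero (ℕ.≤-<-trans ℕ.z≤n q<p)
      p₁≢0 : NonZero p₁
      p₁≢0 = ℕ.>-nonZero (ℕ.≤-<-trans ℕ.z≤n q₁<p₁)
      pp≢0 : NonZero (p * p)
      pp≢0 = ℕ.m*n≢0 p p
      tt≢0 : NonZero (t * t)
      tt≢0 = ℕ.m*n≢0 t t
      nn≢0 : NonZero (n * n)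
      nn≢0 = ℕ.m*n≢0 n n
      ttnn≢0 : NonZero (t * t * (n * n))
      ttnn≢0 = ℕ.m*n≢0 (t * t) (n * n)
      ttnnpp≢0 : NonZero (t * t * (n * n) * (p * p))
      ttnnpp≢0 = ℕ.m*n≢0 (t * t * (n * n)) (p * p)
      K≢0 : NonZero K
      K≢0 = ℕ.m*n≢0 (t * t * (n * n) * (p * p)) p₁

-- Phrased for arbitrary functions on `Fin k`, so that interchanging the two configurations gives
-- the reverse inequality.
rescaled-valencies-≤ : ∀ {k} (T T′ : Fin k → Fin k → Fin k → ℕ) (n n′ : Fin k → ℕ)
  ⦃ _ : ∀ {a} → NonZero (n a) ⦄ (_ᵒ : Fin k → Fin k) →
  (∀ a b c → T′ a b c * T′ a b c * n′ c * (n a * n b) ≡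
             T a b c * T a b c * n c * (n′ a * n′ b)) →
  (∀ a → sum (λ c → T a (a ᵒ) c * n c) ≡ n a * n (a ᵒ)) →
  (∀ a → sum (λ c → T′ a (a ᵒ) c * n′ c) ≡ n′ a * n′ (a ᵒ)) →
  (∀ a → n′ a * n (a ᵒ) ≡ n a * n′ (a ᵒ)) →
  (∀ a → ∃ λ c → NonZero (T a (a ᵒ) c)) →
  ∀ a → n′ a ≤ n a
rescaled-valencies-≤ T T′ n n′ _ᵒ rescaled ∑T ∑T′ ratio-ᵒ support a =
  ℕ.*-cancelʳ-≤ (n′ a) (n a) (n m) (begin
    n′ a * n m  ≤⟨ max a ⟩
    n′ m * n a  ≤⟨ ℕ.*-monoˡ-≤ (n a) (ℕ.≮⇒≥ nm≮n′m) ⟩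
    n m * n a   ≡⟨ ℕ.*-comm (n m) (n a) ⟩
    n a * n m   ∎)
  where
  open ℕ.≤-Reasoning
  m = proj₁ (max-ratio n′ n a)
  max = proj₂ (max-ratio n′ n a)
  b = m ᵒ
  q = n m * n b
  p = n′ m * n′ b

  -- Each total is multiplied by the value of the other, so the two agree; `n m < n′ m` would make
  -- every term of `sum-q` at most that of `sum-p`, and the term at `c₀` smaller.
  sum-q sum-p : ℕ
  sum-q = sum (λ c → T′ m b c * n′ c * q)
  sum-p = sum (λ c → T m b c * n c * p)

  sum-q≡sum-p : sum-q ≡ sum-p
  sum-q≡sum-p = begin-equality
    sum-q    ≡⟨ *-distribʳ-sum q (λ c → T′ m b c * n′ c) ⟨
    sum (λ c → T′ m b c * n′ c) * q   ≡⟨ cong (_* q) (∑T′ m) ⟩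
    p * q  ≡⟨ ℕ.*-comm p q ⟩
    q * p  ≡⟨ cong (_* p) (∑T m) ⟨
    sum (λ c → T m b c * n c) * p     ≡⟨ *-distribʳ-sum p (λ c → T m b c * n c) ⟩
    sum-p    ∎

  nm≮n′m : n m ℕ.≮ n′ m
  nm≮n′m nm<n′m = ℕ.<-irrefl sum-q≡sum-p
    (sum-mono-<
      (λ c → term-≤ {t′ = T′ m b c} {T m b c} (rescaled m b c) (max c) nm<n′m (ratio-ᵒ m))
      (term-< {t′ = T′ m b c₀} {T m b c₀} (rescaled m b c₀) (max c₀) nm<n′m (ratio-ᵒ m)
        ⦃ proj₂ (support m) ⦄))
    where c₀ = proj₁ (support m)

-- The rational `0` lies in the lower cut of `1ℝ` but not in that of `0ℝ`.
if-1-0-reflects : ∀ {p q} {P : Set p} {Q : Set q} (P? : Dec P) (Q? : Dec Q) →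
  (if does P? then 1ℝ else 0ℝ) ≃ (if does Q? then 1ℝ else 0ℝ) → Q → P
if-1-0-reflects (yes p) _       eq q = p
if-1-0-reflects (no _)  (no ¬q) eq q = contradiction q ¬q
if-1-0-reflects (no _)  (yes _) eq q = contradiction
  (Equivalence.from (proj₁ (eq 0ℚ)) (ℚ.positive⁻¹ 1ℚ)) (ℚ.<-irrefl refl)

-- Two configurations matched by `θ`.

open CoherentConfiguration

module Isomorphic (C C′ : CoherentConfiguration) (θ : S C ⤖ S C′)
  (∇̇-preserved : ∀ a b c →
    ∇̇ C′ (Bijection.to θ a) (Bijection.to θ b) (Bijection.to θ c) ≃ ∇̇ C a b c)
  (e-preserved : ∀ a → e C′ (Bijection.to θ a) ≃ e C a)
  where
  open Bijection θ using () renaming (to to θ⟨_⟩)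
  private
    module C = CoherentConfiguration C
    module C′ = CoherentConfiguration C′

  ∇′ : C.S → C.S → C.S → ℕ
  ∇′ a b c = C′.∇ θ⟨ a ⟩ θ⟨ b ⟩ θ⟨ c ⟩

  ‖_‖′ : C.S → ℕ
  ‖ a ‖′ = C′.‖ θ⟨ a ⟩ ‖

  instance
    ‖‖≢0 : ∀ {a} → NonZero C.‖ a ‖
    ‖‖≢0 {a} = C.‖‖-nonZero a
    ‖‖′≢0 : ∀ {a} → NonZero ‖ a ‖′
    ‖‖′≢0 {a} = C′.‖‖-nonZero θ⟨ a ⟩

  -- The only form in which `∇̇-preserved` is used: squared, with denominators cleared.
  ∇-rescaled : ∀ a b c → ∇′ a b c * ∇′ a b c * ‖ c ‖′ * (C.‖ a ‖ * C.‖ b ‖) ≡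
                         C.∇ a b c * C.∇ a b c * C.‖ c ‖ * (‖ a ‖′ * ‖ b ‖′)
  ∇-rescaled a b c = ·√-/-square
    {∇′ a b c} {C.∇ a b c} {c = ‖ c ‖′} {C.‖ c ‖}
    ⦃ ℕ.m*n≢0 ‖ a ‖′ ‖ b ‖′ ⦄ ⦃ ℕ.m*n≢0 C.‖ a ‖ C.‖ b ‖ ⦄
    (Valency.∇̇-√-radicand C′ θ⟨ a ⟩ θ⟨ b ⟩ θ⟨ c ⟩)
    (Valency.∇̇-√-radicand C a b c)
    (subst₂ _≃_ (proj₂ (Valency.∇̇-√ C′ θ⟨ a ⟩ θ⟨ b ⟩ θ⟨ c ⟩))
      (proj₂ (Valency.∇̇-√ C a b c)) (∇̇-preserved a b c))

  ∇′-nonZero : ∀ a b c → NonZero (C.∇ a b c) → NonZero (∇′ a b c)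
  ∇′-nonZero a b c nz = ℕ.≢-nonZero λ ∇′≡0 → ℕ.≢-nonZero⁻¹ rhs ⦃ rhs≢0 ⦄
    (trans (sym (∇-rescaled a b c))
      (cong (λ t → t * t * ‖ c ‖′ * (C.‖ a ‖ * C.‖ b ‖)) ∇′≡0))
    where
    t = C.∇ a b c
    rhs = t * t * C.‖ c ‖ * (‖ a ‖′ * ‖ b ‖′)
    rhs≢0 : NonZero rhs
    rhs≢0 = ℕ.m*n≢0 (t * t * C.‖ c ‖) (‖ a ‖′ * ‖ b ‖′)
      ⦃ ℕ.m*n≢0 (t * t) C.‖ c ‖ ⦃ ℕ.m*n≢0 t t ⦃ nz ⦄ ⦃ nz ⦄ ⦄ ⦄
      ⦃ ℕ.m*n≢0 ‖ a ‖′ ‖ b ‖′ ⦄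

  ∇-diagonal-nonZero : ∀ x y → NonZero (C.∇ (C.class x y) (C.class y x) (C.class x x))
  ∇-diagonal-nonZero x y =
    subst NonZero (sym (Valency.∇-diagonal C x y)) ‖‖≢0

  -- `θ` acts on classes only, so points of `C′` must be found. By `e-preserved`, `θ⟨ 1ₓ ⟩` is
  -- diagonal and contains some `(u , u)`; there `∇′` is nonzero, which gives a path `u → v → u`. In
  -- particular `θ` respects converses.
  image : ∀ x y → ∃ λ u → ∃ λ v → C′.class u v ≡ θ⟨ C.class x y ⟩ ×
          C′.class v u ≡ θ⟨ C.class y x ⟩ × C′.class u u ≡ θ⟨ C.class x x ⟩
  image x y =
    let (u , u′ , uu′∈θ1) = C′.nonempty θ⟨ 1ₓ ⟩
        θ1⊆id = if-1-0-reflects (θ⟨ 1ₓ ⟩ C′.⊆id?) (1ₓ C.⊆id?) (e-preserved 1ₓ)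
                  (C.diagonal 1ₓ x refl)
        uu∈θ1 = subst (λ w → C′.class u w ≡ θ⟨ 1ₓ ⟩) (sym (θ1⊆id u u′ uu′∈θ1)) uu′∈θ1
        (v , uv , vu) = Valency.∇-nonZero⇒path C′ u u
          (subst (NonZero ∘ C′.∇ θ⟨ C.class x y ⟩ θ⟨ C.class y x ⟩) (sym uu∈θ1)
            (∇′-nonZero (C.class x y) (C.class y x) 1ₓ (∇-diagonal-nonZero x y)))
    in u , v , uv , vu , uu∈θ1
    where 1ₓ = C.class x x

  ∇′-diagonal : ∀ x y → ∇′ (C.class x y) (C.class y x) (C.class x x) ≡ ‖ C.class x y ‖′
  ∇′-diagonal x y with image x y
  ... | u , v , uv , vu , uu = trans
    (sym (trans (cong₂ (λ a b → C′.∇ a b (C′.class u u)) uv vu) (cong (C′.∇ _ _) uu)))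
    (trans (Valency.∇-diagonal C′ u v) (cong C′.‖_‖ uv))

  ∑∇′‖‖′ : ∀ x y → let a = C.class x y; b = C.class y x in
           sum (λ c → ∇′ a b c * ‖ c ‖′) ≡ ‖ a ‖′ * ‖ b ‖′
  ∑∇′‖‖′ x y with image x y
  ... | u , v , uv , vu , _ = begin
    sum (λ c → ∇′ a b c * ‖ c ‖′)
      -- `θ` reindexes the sum over classes of `C` as one over classes of `C′`.
      ≡⟨ sum-permute (λ c → C′.∇ θ⟨ a ⟩ θ⟨ b ⟩ c * C′.‖ c ‖) (⤖⇒↔ θ) ⟨
    sum (λ c → C′.∇ θ⟨ a ⟩ θ⟨ b ⟩ c * C′.‖ c ‖)
      ≡⟨ cong₂ (λ a b → sum (λ c → C′.∇ a b c * C′.‖ c ‖)) uv vu ⟨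
    sum (λ c → C′.∇ (C′.class u v) (C′.class v u) c * C′.‖ c ‖)
      ≡⟨ Valency.∑∇‖‖ C′ u v ⟩
    C′.‖ C′.class u v ‖ * C′.‖ C′.class v u ‖
      ≡⟨ cong₂ (λ a b → C′.‖ a ‖ * C′.‖ b ‖) uv vu ⟩
    ‖ a ‖′ * ‖ b ‖′ ∎
    where
    open ≡-Reasoning
    a = C.class x y
    b = C.class y x

  -- At `a = b = c = 1ₓ`, `∇-rescaled` becomes `n′³ n² = n³ n′²`.
  ‖‖-diagonal : ∀ x → ‖ C.class x x ‖′ ≡ C.‖ C.class x x ‖
  ‖‖-diagonal x = ℕ.*-cancelʳ-≡ n′ n (n′ * n′ * (n * n))
    ⦃ ℕ.m*n≢0 (n′ * n′) (n * n) ⦃ ℕ.m*n≢0 n′ n′ ⦄ ⦃ ℕ.m*n≢0 n n ⦄ ⦄ (begin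
      n′ * (n′ * n′ * (n * n))
        ≡⟨ solve 2 (λ n′ n → n′ :* (n′ :* n′ :* (n :* n)) := n′ :* n′ :* n′ :* (n :* n)) refl n′ n ⟩
      n′ * n′ * n′ * (n * n)
        ≡⟨ cong (λ t → t * t * n′ * (n * n)) (∇′-diagonal x x) ⟨
      ∇′ 1ₓ 1ₓ 1ₓ * ∇′ 1ₓ 1ₓ 1ₓ * n′ * (n * n)      ≡⟨ ∇-rescaled 1ₓ 1ₓ 1ₓ ⟩
      C.∇ 1ₓ 1ₓ 1ₓ * C.∇ 1ₓ 1ₓ 1ₓ * n * (n′ * n′)
        ≡⟨ cong (λ t → t * t * n * (n′ * n′)) (Valency.∇-diagonal C x x) ⟩
      n * n * n * (n′ * n′)
        ≡⟨ solve 2 (λ n′ n → n :* n :* n :* (n′ :* n′) := n :* (n′ :* n′ :* (n :* n))) refl n′ n ⟩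
      n * (n′ * n′ * (n * n)) ∎)
    where
    open ≡-Reasoning
    open ℕ.+-*-Solver
    1ₓ = C.class x x
    n′ = ‖ 1ₓ ‖′
    n  = C.‖ 1ₓ ‖

  -- At `c = 1ₓ`, `∇-rescaled` becomes `n′² d n n* = n² d n′ n*′`, with the same `d` on both sides
  -- by `‖‖-diagonal`.
  ‖‖-converse-ratio : ∀ x y → let a = C.class x y; b = C.class y x in
                      ‖ a ‖′ * C.‖ b ‖ ≡ C.‖ a ‖ * ‖ b ‖′
  ‖‖-converse-ratio x y = ℕ.*-cancelˡ-≡ _ _ (n′ * n * d)
    ⦃ ℕ.m*n≢0 (n′ * n) d ⦃ ℕ.m*n≢0 n′ n ⦄ ⦄ (begin
      n′ * n * d * (n′ * n*)
        ≡⟨ solve 4 (λ n′ n d n* → n′ :* n :* d :* (n′ :* n*)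
             := n′ :* n′ :* d :* (n :* n*)) refl n′ n d n* ⟩
      n′ * n′ * d * (n * n*)
        ≡⟨ cong₂ (λ t d → t * t * d * (n * n*)) (∇′-diagonal x y) (‖‖-diagonal x) ⟨
      ∇′ a b 1ₓ * ∇′ a b 1ₓ * ‖ 1ₓ ‖′ * (n * n*)    ≡⟨ ∇-rescaled a b 1ₓ ⟩
      C.∇ a b 1ₓ * C.∇ a b 1ₓ * d * (n′ * n*′)
        ≡⟨ cong (λ t → t * t * d * (n′ * n*′)) (Valency.∇-diagonal C x y) ⟩
      n * n * d * (n′ * n*′)
        ≡⟨ solve 4 (λ n′ n d n*′ → n :* n :* d :* (n′ :* n*′)
             := n′ :* n :* d :* (n :* n*′)) refl n′ n d n*′ ⟩
      n′ * n * d * (n * n*′) ∎)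
    where
    open ≡-Reasoning
    open ℕ.+-*-Solver
    a = C.class x y
    b = C.class y x
    1ₓ = C.class x x
    n′ = ‖ a ‖′
    n  = C.‖ a ‖
    n*′ = ‖ b ‖′
    n* = C.‖ b ‖
    d = C.‖ 1ₓ ‖

  -- Read off at the chosen pair of `a`, so that facts about `class x y` and `class y x` transfer by
  -- one `subst` in `ᵒ-elim`.
  _ᵒ : C.S → C.S
  a ᵒ = let (x , y , _) = C.nonempty a in C.class y x

  ᵒ-elim : ∀ {p} (P : C.S → C.S → Set p) →
           (∀ x y → P (C.class x y) (C.class y x)) → ∀ a → P a (a ᵒ)
  ᵒ-elim P Pxy a = let (x , y , xy∈a) = C.nonempty a in
    subst (λ a → P a (C.class y x)) xy∈a (Pxy x y)

  ‖‖-preserved : ∀ a → ‖ a ‖′ ≡ C.‖ a ‖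
  ‖‖-preserved a = ℕ.≤-antisym
    (rescaled-valencies-≤ C.∇ ∇′ C.‖_‖ ‖_‖′ _ᵒ ∇-rescaled ∑ ∑′ ratio
      (ᵒ-elim (λ a b → ∃ λ c → NonZero (C.∇ a b c))
        λ x y → C.class x x , ∇-diagonal-nonZero x y) a)
    -- The same bound with the two configurations interchanged.
    (rescaled-valencies-≤ ∇′ C.∇ ‖_‖′ C.‖_‖ _ᵒ
      (λ a b c → sym (∇-rescaled a b c)) ∑′ ∑ (λ a → sym (ratio a))
      (ᵒ-elim (λ a b → ∃ λ c → NonZero (∇′ a b c))
        λ x y → C.class x x , ∇′-nonZero _ _ _ (∇-diagonal-nonZero x y)) a)
    where
    ∑ = ᵒ-elim (λ a b → sum (λ c → C.∇ a b c * C.‖ c ‖) ≡ C.‖ a ‖ * C.‖ b ‖)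
          (Valency.∑∇‖‖ C)
    ∑′ = ᵒ-elim (λ a b → sum (λ c → ∇′ a b c * ‖ c ‖′) ≡ ‖ a ‖′ * ‖ b ‖′) ∑∇′‖‖′
    ratio = ᵒ-elim (λ a b → ‖ a ‖′ * C.‖ b ‖ ≡ C.‖ a ‖ * ‖ b ‖′) ‖‖-converse-ratio

  -- Once valencies agree, they cancel from `∇-rescaled`, leaving an equality of squares in `ℕ`.
  ∇-preserved : ∀ a b c → ∇′ a b c ≡ C.∇ a b c
  ∇-preserved a b c = square-injective
    (ℕ.*-cancelʳ-≡ _ _ C.‖ c ‖ (ℕ.*-cancelʳ-≡ _ _ (C.‖ a ‖ * C.‖ b ‖) ⦃ ℕ.m*n≢0 C.‖ a ‖ C.‖ b ‖ ⦄
      (begin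
        ∇′ a b c * ∇′ a b c * C.‖ c ‖ * (C.‖ a ‖ * C.‖ b ‖)
          ≡⟨ cong (λ n → ∇′ a b c * ∇′ a b c * n * (C.‖ a ‖ * C.‖ b ‖)) (‖‖-preserved c) ⟨
        ∇′ a b c * ∇′ a b c * ‖ c ‖′ * (C.‖ a ‖ * C.‖ b ‖)  ≡⟨ ∇-rescaled a b c ⟩
        C.∇ a b c * C.∇ a b c * C.‖ c ‖ * (‖ a ‖′ * ‖ b ‖′)
          ≡⟨ cong₂ (λ m n → C.∇ a b c * C.∇ a b c * C.‖ c ‖ * (m * n))
               (‖‖-preserved a) (‖‖-preserved b) ⟩
        C.∇ a b c * C.∇ a b c * C.‖ c ‖ * (C.‖ a ‖ * C.‖ b ‖) ∎)))
    where open ≡-Reasoning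

theorem8p3 : (C C′ : CoherentConfiguration) (θ : S C ⤖ S C′) →
    let open Bijection θ using () renaming (to to θ⟨_⟩) in
    (∀ a b c → ∇̇ C′ θ⟨ a ⟩ θ⟨ b ⟩ θ⟨ c ⟩ ≃ ∇̇ C a b c) →
    (∀ a → e C′ θ⟨ a ⟩ ≃ e C a) →
    ∀ a b c → ∇ C′ θ⟨ a ⟩ θ⟨ b ⟩ θ⟨ c ⟩ ≡ ∇ C a b c
theorem8p3 C C′ θ = Isomorphic.∇-preserved C C′ θ
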